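{- For every integer $n\ge 0$, the following four expressions are equal: \begin{align*} \text{(i)}\quad & \frac{4}{n+1}\sum_{0\le k<\ell<\lceil n/2\rceil}\frac{\binom nk}{\binom n\ell}+[n\text{ even}]\,\frac{1}{n+1}\left(\frac{2^n}{\binom{n}{n/2}}-1\right)+1,\\ \text{(ii)}\quad & \frac{2}{\lfloor n/2\rfloor+1}\sum_{0\le k<\ell\le\lfloor n/2\rfloor}\frac{\binom{2\lfloor n/2\rfloor+1}{k}}{\binom{2\lfloor n/2\rfloor+1}{\ell}}+1,\\ \text{(iii)}\quad & \frac{1}{n+1}\sum_{m=0}^{\lfloor n/2\rfloor}\sum_{\ell=m}^{n-m}\frac{\binom{2m}{m}\binom{n-2m}{\ell-m}}{\binom n\ell},\\ \text{(iv)}\quad & H^{\mathrm{odd}}_{n+1}. \end{align*}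
   Context: $[\mathit{expr}]$ is $1$ if $\mathit{expr}$ is true and $0$ otherwise (the term with $[n\text{ even}]$ is $0$ for odd $n$). $H^{\mathrm{odd}}_n=\sum_{1\le m\le n,\ m\text{ odd}}\frac1m$. The double sums in (i) and (ii) run over pairs of integers $(k,\ell)$. -}

module Defs where

open import Data.Bool.Base using (if_then_else_)
open import Data.Fin.Base using (toℕ)
open import Data.Integer.Base using (+_)
open import Data.Nat.Base as ℕ using (ℕ; zero; suc; _∸_; _^_; ⌊_/2⌋; ⌈_/2⌉)
open import Data.Nat.Combinatorics using (_C_)
open import Data.Nat.Divisibility using (_∣?_)
open import Data.Rational.Base using (ℚ; 0ℚ; 1ℚ; _+_; _-_; _*_; _/_)
open import Data.Rational.Properties using (+-0-commutativeMonoid)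
open import Level using (Level)
open import Relation.Nullary.Decidable using (Dec; does; ¬?)

import Algebra.Properties.CommutativeMonoid.Sum as Sum

private
  variable
    p : Level

infixl 7 _//_

-- The quotient of two naturals as a rational.  The value at a zero
-- denominator is a dummy: below, every denominator is either a binomial
-- coefficient N C ℓ with ℓ ≤ N or an integer m ≥ 1, hence positive.
_//_ : ℕ → ℕ → ℚ
a // zero  = 0ℚ
a // suc b = (+ a) / suc b

-- Both sums are empty when the range is.
sum≤< : ℕ → ℕ → (ℕ → ℚ) → ℚ
sum≤< a b f = Sum.sum +-0-commutativeMonoid {b ∸ a} (λ j → f (a ℕ.+ toℕ j))

sum≤≤ : ℕ → ℕ → (ℕ → ℚ) → ℚ
sum≤≤ a b = sum≤< a (suc b)

infixl 10 sum≤< sum≤≤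
syntax sum≤< a b (λ i → e) = ∑[ a ≤ i < b ] e
syntax sum≤≤ a b (λ i → e) = ∑[ a ≤ i ≤ b ] e

⟦_⟧ : {P : Set p} → Dec P → ℚ
⟦ P? ⟧ = if does P? then 1ℚ else 0ℚ

Hᵒᵈᵈ : ℕ → ℚ
Hᵒᵈᵈ n = ∑[ 1 ≤ m ≤ n ] (⟦ ¬? (2 ∣? m) ⟧ * (1 // m))

-- A sum over pairs k < ℓ is written with ℓ as the outer index.
-- In the bracketed term ⌊ n /2⌋ is n/2, since the bracket vanishes for odd n.
exprI : ℕ → ℚ
exprI n =
  ((+ 4) / suc n) * (∑[ 0 ≤ ℓ < ⌈ n /2⌉ ] (∑[ 0 ≤ k < ℓ ] ((n C k) // (n C ℓ))))
  + ⟦ 2 ∣? n ⟧ * (((+ 1) / suc n) * ((2 ^ n) // (n C ⌊ n /2⌋) - 1ℚ))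
  + 1ℚ

exprII : ℕ → ℚ
exprII n =
  ((+ 2) / suc ⌊ n /2⌋)
    * (∑[ 0 ≤ ℓ ≤ ⌊ n /2⌋ ] (∑[ 0 ≤ k < ℓ ] ((N C k) // (N C ℓ))))
  + 1ℚ
  where
  N : ℕ
  N = 2 ℕ.* ⌊ n /2⌋ ℕ.+ 1

-- The truncated subtractions are exact: 2m ≤ n and m ≤ ℓ on the range.
exprIII : ℕ → ℚ
exprIII n =
  ((+ 1) / suc n)
    * (∑[ 0 ≤ m ≤ ⌊ n /2⌋ ] (∑[ m ≤ ℓ ≤ n ∸ m ]
        ((((2 ℕ.* m) C m) ℕ.* ((n ∸ 2 ℕ.* m) C (ℓ ∸ m))) // (n C ℓ))))

exprIV : ℕ → ℚ
exprIV n = Hᵒᵈᵈ (n ℕ.+ 1)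

{-# OPTIONS --safe #-}

-- All four expressions equal the sum of 1/(2m + 1) over 0 ≤ m ≤ r, where r = ⌊n/2⌋.
--
-- For (i) and (ii), put F(n, l) = Σ_{k<l} C(n,k)/C(n,l) and U(n, L) = Σ_{l<L} F(n, l).
-- The absorption identity gives (n − l) F(n, l+1) = (l + 1)(F(n, l) + 1), and from this
-- alone two inductions yield
--   (n + 1) F(n+1, l) = 2(n + 1 − l) F(n, l) − l,
--   (n + 1) U(n+1, L) = (n + 2) U(n, L) + L − (n + 1 − L) F(n, L).
-- With W_r = U(2r+1, r+1), going from row 2r + 1 to row 2r + 3 all values of F cancel:
--   2 W_{r+1}/(r + 2) = 2 W_r/(r + 1) + 1/(2r + 3).
-- Going from row 2r to row 2r + 1 relates (i) to (ii), where the term with 2ⁿ appears as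
-- 2 F(2r, r) + 1 = 4ʳ/C(2r, r).
--
-- For (iii), 1/((n + 1) C(n,k)) is the Beta integral ∫₀¹ xᵏ(1 − x)ⁿ⁻ᵏ dx, and expanding
-- (x + (1 − x))ᴺ under the integral collapses the sum over ℓ to 1/(2m + 1) for each m.
module Submission where

open import Defs
open import Data.Fin.Base using (toℕ)
open import Data.Fin.Properties using (toℕ<n)
open import Data.Integer.Base as ℤ using (+_)
import Data.Integer.Properties as ℤ
open import Data.Nat.Base as ℕ
  using (ℕ; zero; suc; s≤s; _∸_; _^_; ⌊_/2⌋; ⌈_/2⌉)
import Data.Nat.Properties as ℕ
open import Data.Nat.Combinatorics using (_C_; nC1≡n; nCk+nC[k+1]≡[n+1]C[k+1]; k>n⇒nCk≡0)
open import Data.Nat.Divisibility using (_∣_; _∣?_; ∣m+n∣m⇒∣n; n∣m*n; ∣1⇒≡1)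
open import Data.Product.Base using (_×_; _,_)
open import Data.Rational.Base
  using (ℚ; 0ℚ; 1ℚ; _+_; _-_; _*_; fromℚᵘ)
open import Data.Rational.Properties
open import Data.Rational.Solver using (module +-*-Solver)
import Data.Rational.Unnormalised.Base as ℚᵘ
import Data.Rational.Unnormalised.Properties as ℚᵘ
open import Relation.Nullary using (¬_; Dec; yes; no; contradiction; ¬?)
open import Relation.Binary.PropositionalEquality
  using (_≡_; refl; sym; trans; cong; cong₂; subst; subst₂; module ≡-Reasoning)
open import Algebra.Bundles using (CommutativeRing)
open import Algebra.Properties.Semiring.Sum (CommutativeRing.semiring +-*-commutativeRing)
  using (sum-cong-≗; ∑-distrib-+; *-distribˡ-sum; *-distribʳ-sum)

open import Algebra.Properties.Group +-0-group using () renaming (∙-cancelʳ to +-cancelʳ)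

open +-*-Solver using (solve; con; _:+_; _:*_; _:-_; _:=_)
open ≡-Reasoning

-- Naturals and their reciprocals inside ℚ.

fromℚᵘ-homo-+ : ∀ p q r → r ℚᵘ.≃ p ℚᵘ.+ q → fromℚᵘ r ≡ fromℚᵘ p + fromℚᵘ q
fromℚᵘ-homo-+ p q r r≃p+q = toℚᵘ-injective
  (ℚᵘ.≃-trans (toℚᵘ-fromℚᵘ r) (ℚᵘ.≃-trans r≃p+q
  (ℚᵘ.≃-sym (ℚᵘ.≃-trans (toℚᵘ-homo-+ (fromℚᵘ p) (fromℚᵘ q))
    (ℚᵘ.+-cong (toℚᵘ-fromℚᵘ p) (toℚᵘ-fromℚᵘ q))))))

fromℚᵘ-homo-* : ∀ p q r → r ℚᵘ.≃ p ℚᵘ.* q → fromℚᵘ r ≡ fromℚᵘ p * fromℚᵘ q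
fromℚᵘ-homo-* p q r r≃p*q = toℚᵘ-injective
  (ℚᵘ.≃-trans (toℚᵘ-fromℚᵘ r) (ℚᵘ.≃-trans r≃p*q
  (ℚᵘ.≃-sym (ℚᵘ.≃-trans (toℚᵘ-homo-* (fromℚᵘ p) (fromℚᵘ q))
    (ℚᵘ.*-cong (toℚᵘ-fromℚᵘ p) (toℚᵘ-fromℚᵘ q))))))

-- ι and recip are opaque because unfolding n // d on an open numeral exposes
-- a stuck gcd computation, which makes conversion checking very slow.
opaque
  ι : ℕ → ℚ
  ι n = n // 1

  recip : ℕ → ℚ
  recip n = 1 // n

  ι-0 : ι 0 ≡ 0ℚ
  ι-0 = refl

  ι-1 : ι 1 ≡ 1ℚ
  ι-1 = refl

  ι-+ : ∀ m n → ι (m ℕ.+ n) ≡ ι m + ι n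
  ι-+ m n = fromℚᵘ-homo-+ (ℚᵘ.mkℚᵘ (+ m) 0) (ℚᵘ.mkℚᵘ (+ n) 0) (ℚᵘ.mkℚᵘ (+ (m ℕ.+ n)) 0)
    (ℚᵘ.*≡* (cong (ℤ._* (+ 1))
      (sym (cong₂ ℤ._+_ (ℤ.*-identityʳ (+ m)) (ℤ.*-identityʳ (+ n))))))

  ι-* : ∀ m n → ι (m ℕ.* n) ≡ ι m * ι n
  ι-* m n = fromℚᵘ-homo-* (ℚᵘ.mkℚᵘ (+ m) 0) (ℚᵘ.mkℚᵘ (+ n) 0) (ℚᵘ.mkℚᵘ (+ (m ℕ.* n)) 0)
    (ℚᵘ.*≡* (cong (ℤ._* (+ 1)) (ℤ.pos-* m n)))

  //≡ι*recip : ∀ a b → a // b ≡ ι a * recip b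
  //≡ι*recip a zero    = sym (*-zeroʳ (ι a))
  //≡ι*recip a (suc b) = fromℚᵘ-homo-* (ℚᵘ.mkℚᵘ (+ a) 0) (ℚᵘ.mkℚᵘ (+ 1) b) (ℚᵘ.mkℚᵘ (+ a) b)
    (ℚᵘ.*≡* (cong₂ ℤ._*_ (sym (ℤ.*-identityʳ (+ a))) (cong +_ (ℕ.*-identityˡ (suc b)))))

  recip-inverse : ∀ b .{{_ : ℕ.NonZero b}} → recip b * ι b ≡ 1ℚ
  recip-inverse (suc b) = sym (fromℚᵘ-homo-*
    (ℚᵘ.mkℚᵘ (+ 1) b) (ℚᵘ.mkℚᵘ (+ suc b) 0) ℚᵘ.1ℚᵘ
    (ℚᵘ.*≡* (trans (ℤ.*-identityˡ (+ (suc b ℕ.* 1)))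
      (sym (trans (ℤ.*-identityʳ _) (trans (ℤ.*-identityˡ (+ suc b))
        (cong +_ (sym (ℕ.*-identityʳ (suc b))))))))))

ι-suc : ∀ n → ι (suc n) ≡ 1ℚ + ι n
ι-suc n = trans (ι-+ 1 n) (cong (_+ ι n) ι-1)

-- Derives x ≡ y from a ≡ b when x − y = a − b is a ring identity; b and a are moved
-- across so that the identity can be given to the ring solver.
≡-shift : ∀ {a b x y : ℚ} → a ≡ b → x + b ≡ y + a → x ≡ y
≡-shift {a} {x = x} {y} refl = +-cancelʳ a x y

-- The factor is the image of `suc n`, hence invertible. Writing it as `1ℚ + ι n` keeps it a
-- polynomial in `ι n`, as the ring solver expects.
*-cancelˡ-suc : ∀ n {x y} → (1ℚ + ι n) * x ≡ (1ℚ + ι n) * y → x ≡ y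
*-cancelˡ-suc n {x} {y} eq = begin
  x                                  ≡⟨ unit x ⟨
  recip (suc n) * ((1ℚ + ι n) * x)    ≡⟨ cong (recip (suc n) *_) eq ⟩
  recip (suc n) * ((1ℚ + ι n) * y)    ≡⟨ unit y ⟩
  y                                  ∎
  where
  unit : ∀ z → recip (suc n) * ((1ℚ + ι n) * z) ≡ z
  unit z = begin
    recip (suc n) * ((1ℚ + ι n) * z)  ≡⟨ *-assoc (recip (suc n)) (1ℚ + ι n) z ⟨
    recip (suc n) * (1ℚ + ι n) * z    ≡⟨ cong (λ t → recip (suc n) * t * z) (ι-suc n) ⟨
    recip (suc n) * ι (suc n) * z     ≡⟨ cong (_* z) (recip-inverse (suc n)) ⟩
    1ℚ * z                           ≡⟨ *-identityˡ z ⟩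
    z                                ∎

-- Binomial coefficients in ℚ.

pascal : ∀ n k → ι (suc n C suc k) ≡ ι (n C k) + ι (n C suc k)
pascal n k = trans (cong ι (sym (nCk+nC[k+1]≡[n+1]C[k+1] n k))) (ι-+ (n C k) (n C suc k))

-- No side condition: both sides vanish for k ≥ n.
absorption : ∀ n k → (ι n - ι k) * ι (n C k) ≡ (1ℚ + ι k) * ι (n C suc k)
absorption zero    zero    rewrite ι-0 | ι-1 = refl
absorption zero    (suc k) rewrite ι-0 =
  trans (*-zeroʳ (0ℚ - ι (suc k))) (sym (*-zeroʳ (1ℚ + ι (suc k))))
absorption (suc n) zero    rewrite ι-0 | ι-1 | nC1≡n (suc n) =
  solve 1 (λ a → (a :- con 0ℚ) :* con 1ℚ := (con 1ℚ :+ con 0ℚ) :* a) refl (ι (suc n))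
absorption (suc n) (suc k)
  rewrite pascal n k | pascal n (suc k) | ι-suc n | ι-suc k
  with absorption n k | absorption n (suc k)
... | ih₁ | ih₂ rewrite ι-suc k = ≡-shift (cong₂ _+_ ih₁ ih₂)
    (solve 5 (λ n k a b c →
        ((con 1ℚ :+ n) :- (con 1ℚ :+ k)) :* (a :+ b)
          :+ ((con 1ℚ :+ k) :* b :+ (con 1ℚ :+ (con 1ℚ :+ k)) :* c)
      := (con 1ℚ :+ (con 1ℚ :+ k)) :* (b :+ c)
          :+ ((n :- k) :* a :+ (n :- (con 1ℚ :+ k)) :* b))
      refl (ι n) (ι k) (ι (n C k)) (ι (n C suc k)) (ι (n C suc (suc k))))

-- By Pascal's rule this is `absorption` with `(1ℚ + ι k) * ι (n C k)` added to both sides.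
absorption-diagonal : ∀ n k → (1ℚ + ι k) * ι (suc n C suc k) ≡ (1ℚ + ι n) * ι (n C k)
absorption-diagonal n k rewrite pascal n k = ≡-shift (sym (absorption n k))
  (solve 4 (λ n k a b →
      (con 1ℚ :+ k) :* (a :+ b) :+ (n :- k) :* a
    := (con 1ℚ :+ n) :* a :+ (con 1ℚ :+ k) :* b)
    refl (ι n) (ι k) (ι (n C k)) (ι (n C suc k)))

absorption-row : ∀ n k → ((1ℚ + ι n) - ι k) * ι (suc n C k) ≡ (1ℚ + ι n) * ι (n C k)
absorption-row n k = begin
  ((1ℚ + ι n) - ι k) * ι (suc n C k)  ≡⟨ cong (λ t → (t - ι k) * ι (suc n C k)) (ι-suc n) ⟨
  (ι (suc n) - ι k) * ι (suc n C k)   ≡⟨ absorption (suc n) k ⟩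
  (1ℚ + ι k) * ι (suc n C suc k)      ≡⟨ absorption-diagonal n k ⟩
  (1ℚ + ι n) * ι (n C k)              ∎

C-nonZero : ∀ {n k} → k ℕ.≤ n → ℕ.NonZero (n C k)
C-nonZero {n}     {zero}  _         = _
C-nonZero {suc n} {suc k} (s≤s k≤n) = subst ℕ.NonZero (nCk+nC[k+1]≡[n+1]C[k+1] n k)
  (ℕ.>-nonZero (ℕ.m≤n⇒m≤n+o (n C suc k) (ℕ.>-nonZero⁻¹ (n C k) {{C-nonZero k≤n}})))

recip-C : ∀ {n k} → k ℕ.≤ n → recip (n C k) * ι (n C k) ≡ 1ℚ
recip-C {n} {k} k≤n = recip-inverse (n C k) {{C-nonZero k≤n}}

-- Multiplying `e * c ≡ f * d` by `p * q` carries a relation between binomial coefficients over to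
-- their reciprocals.
recip-cross : ∀ p q c d e f → p * c ≡ 1ℚ → q * d ≡ 1ℚ → e * c ≡ f * d → e * q ≡ f * p
recip-cross p q c d e f pc≡1 qd≡1 ec≡fd = begin
  e * q              ≡⟨ *-identityʳ (e * q) ⟨
  e * q * 1ℚ         ≡⟨ cong (e * q *_) pc≡1 ⟨
  e * q * (p * c)    ≡⟨ solve 4 (λ e q p c → e :* q :* (p :* c) := p :* q :* (e :* c)) refl e q p c ⟩
  p * q * (e * c)    ≡⟨ cong (p * q *_) ec≡fd ⟩
  p * q * (f * d)    ≡⟨ solve 4 (λ p q f d → p :* q :* (f :* d) := f :* p :* (q :* d)) refl p q f d ⟩
  f * p * (q * d)    ≡⟨ cong (f * p *_) qd≡1 ⟩
  f * p * 1ℚ         ≡⟨ *-identityʳ (f * p) ⟩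
  f * p              ∎

-- Finite sums.

sum≤<-last : ∀ n f → sum≤< 0 (suc n) f ≡ sum≤< 0 n f + f n
sum≤<-last zero    f = trans (+-identityʳ (f 0)) (sym (+-identityˡ (f 0)))
sum≤<-last (suc n) f = trans (cong (λ t → f 0 + t) (sum≤<-last n (λ k → f (suc k))))
  (sym (+-assoc (f 0) (sum≤< 0 n (λ k → f (suc k))) (f (suc n))))

sum≤<-cong : ∀ n {f g} → (∀ k → k ℕ.< n → f k ≡ g k) → sum≤< 0 n f ≡ sum≤< 0 n g
sum≤<-cong n f≗g = sum-cong-≗ {n} (λ j → f≗g (toℕ j) (toℕ<n j))

-- Partial row sums divided by a binomial coefficient.

rowSum : ℕ → ℕ → ℚ
rowSum n l = sum≤< 0 l (λ k → ι (n C k))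

F : ℕ → ℕ → ℚ
F n l = sum≤< 0 l (λ k → (n C k) // (n C l))

F≡rowSum*recip : ∀ n l → F n l ≡ rowSum n l * recip (n C l)
F≡rowSum*recip n l = trans
  (sum≤<-cong l (λ k _ → //≡ι*recip (n C k) (n C l)))
  (sym (*-distribʳ-sum {l} (recip (n C l)) (λ k → ι (n C toℕ k))))

-- The numerator gains the term C(n,l), and `absorption` trades the reciprocal of C(n,l+1) for that
-- of C(n,l). The bound `l < n` makes both coefficients invertible.
F-step : ∀ {n l} → l ℕ.< n → (ι n - ι l) * F n (suc l) ≡ (1ℚ + ι l) * (F n l + 1ℚ)
F-step {n} {l} l<n = begin
  (ι n - ι l) * F n (suc l)                    ≡⟨ cong ((ι n - ι l) *_) (F≡rowSum*recip n (suc l)) ⟩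
  (ι n - ι l) * (rowSum n (suc l) * q)         ≡⟨ cong (λ t → (ι n - ι l) * (t * q)) (sum≤<-last l (λ k → ι (n C k))) ⟩
  (ι n - ι l) * ((A + c) * q)                  ≡⟨ solve 4 (λ e a c q → e :* ((a :+ c) :* q) := e :* q :* (a :+ c)) refl (ι n - ι l) A c q ⟩
  (ι n - ι l) * q * (A + c)                    ≡⟨ cong (_* (A + c)) cross ⟩
  (1ℚ + ι l) * p * (A + c)                     ≡⟨ solve 4 (λ f a c p → f :* p :* (a :+ c) := f :* (a :* p :+ p :* c)) refl (1ℚ + ι l) A c p ⟩
  (1ℚ + ι l) * (A * p + p * c)                 ≡⟨ cong (λ t → (1ℚ + ι l) * (A * p + t)) (recip-C (ℕ.<⇒≤ l<n)) ⟩
  (1ℚ + ι l) * (A * p + 1ℚ)                    ≡⟨ cong (λ t → (1ℚ + ι l) * (t + 1ℚ)) (F≡rowSum*recip n l) ⟨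
  (1ℚ + ι l) * (F n l + 1ℚ)                    ∎
  where
  A = rowSum n l
  c = ι (n C l)
  p = recip (n C l)
  q = recip (n C suc l)
  cross : (ι n - ι l) * q ≡ (1ℚ + ι l) * p
  cross = recip-cross p q c (ι (n C suc l)) (ι n - ι l) (1ℚ + ι l)
    (recip-C (ℕ.<⇒≤ l<n)) (recip-C l<n) (absorption n l)

2ℚ : ℚ
2ℚ = 1ℚ + 1ℚ

ι-∸ : ∀ {m n} → m ℕ.≤ n → ι (n ∸ m) ≡ ι n - ι m
ι-∸ {m} {n} m≤n = ≡-shift (trans (sym (ι-+ (n ∸ m) m)) (cong ι (ℕ.m∸n+n≡m m≤n)))
  (solve 3 (λ d n m → d :+ n := (n :- m) :+ (d :+ m)) refl (ι (n ∸ m)) (ι n) (ι m))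

F-suc : ∀ {n l} → l ℕ.≤ n →
  (1ℚ + ι n) * F (suc n) l ≡ 2ℚ * ((1ℚ + ι n) - ι l) * F n l - ι l
F-suc {n} {zero} _ rewrite ι-0 =
  solve 1 (λ n → (con 1ℚ :+ n) :* con 0ℚ
    := con 2ℚ :* ((con 1ℚ :+ n) :- con 0ℚ) :* con 0ℚ :- con 0ℚ) refl (ι n)
-- Both sides are multiplied by n + 1 - l, which is positive because l < n, so it can be cancelled
-- afterwards as the successor of `n ∸ l`.
F-suc {n} {suc l} l<n rewrite ι-suc l = *-cancelˡ-suc (n ∸ l)
  (subst (λ t → (1ℚ + t) * ((1ℚ + ι n) * F (suc n) (suc l))
              ≡ (1ℚ + t) * (2ℚ * ((1ℚ + ι n) - (1ℚ + ι l)) * F n (suc l) - (1ℚ + ι l)))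
    (sym (ι-∸ l≤n)) scaled)
  where
  l≤n = ℕ.<⇒≤ l<n

  step : ((1ℚ + ι n) - ι l) * F (suc n) (suc l) ≡ (1ℚ + ι l) * (F (suc n) l + 1ℚ)
  step rewrite sym (ι-suc n) = F-step (ℕ.m<n⇒m<1+n l<n)

  scaled : (1ℚ + (ι n - ι l)) * ((1ℚ + ι n) * F (suc n) (suc l))
         ≡ (1ℚ + (ι n - ι l)) * (2ℚ * ((1ℚ + ι n) - (1ℚ + ι l)) * F n (suc l) - (1ℚ + ι l))
  -- `step` lowers l in row n + 1, the induction hypothesis passes to row n, and `F-step` raises l
  -- again there. The multipliers are chosen so that both values at l drop out.
  scaled = ≡-shift
    (cong₂ _+_ (cong ((1ℚ + ι n) *_) step)
    (cong₂ _+_ (cong ((1ℚ + ι l) *_) (F-suc l≤n))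
               (cong (2ℚ * (1ℚ + (ι n - ι l)) *_) (sym (F-step l<n)))))
    (solve 6 (λ n l x y f g →
        (con 1ℚ :+ (n :- l)) :* ((con 1ℚ :+ n) :* y)
          :+ ((con 1ℚ :+ n) :* ((con 1ℚ :+ l) :* (x :+ con 1ℚ))
          :+ ((con 1ℚ :+ l) :* (con 2ℚ :* ((con 1ℚ :+ n) :- l) :* f :- l)
          :+ con 2ℚ :* (con 1ℚ :+ (n :- l)) :* ((n :- l) :* g)))
      := (con 1ℚ :+ (n :- l)) :* (con 2ℚ :* ((con 1ℚ :+ n) :- (con 1ℚ :+ l)) :* g :- (con 1ℚ :+ l))
          :+ ((con 1ℚ :+ n) :* (((con 1ℚ :+ n) :- l) :* y)
          :+ ((con 1ℚ :+ l) :* ((con 1ℚ :+ n) :* x)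
          :+ con 2ℚ :* (con 1ℚ :+ (n :- l)) :* ((con 1ℚ :+ l) :* (f :+ con 1ℚ)))))
      refl (ι n) (ι l) (F (suc n) l) (F (suc n) (suc l)) (F n l) (F n (suc l)))

-- Double sums and their passage to the next row.

U : ℕ → ℕ → ℚ
U n L = sum≤< 0 L (F n)

-- In the induction step, adding `F-suc` at L leaves F(n,L) with coefficient n + 1 - L = (n + 2) -
-- (L + 1). The n + 2 extends the double sum, and `F-step` turns the L + 1 into the new boundary
-- term.
U-suc : ∀ {n L} → L ℕ.≤ n →
  (1ℚ + ι n) * U (suc n) L ≡ (2ℚ + ι n) * U n L + ι L - ((1ℚ + ι n) - ι L) * F n L
U-suc {n} {zero} _ rewrite ι-0 =
  solve 1 (λ n → (con 1ℚ :+ n) :* con 0ℚ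
    := (con 2ℚ :+ n) :* con 0ℚ :+ con 0ℚ :- ((con 1ℚ :+ n) :- con 0ℚ) :* con 0ℚ) refl (ι n)
U-suc {n} {suc L} L<n
  rewrite ι-suc L | sum≤<-last L (F (suc n)) | sum≤<-last L (F n) = ≡-shift
    (cong₂ _+_ (U-suc L≤n) (cong₂ _+_ (F-suc L≤n) (F-step L<n)))
    (solve 7 (λ n l u v x f g →
        (con 1ℚ :+ n) :* (v :+ x)
          :+ (((con 2ℚ :+ n) :* u :+ l :- ((con 1ℚ :+ n) :- l) :* f)
          :+ ((con 2ℚ :* ((con 1ℚ :+ n) :- l) :* f :- l)
          :+ (con 1ℚ :+ l) :* (f :+ con 1ℚ)))
      := ((con 2ℚ :+ n) :* (u :+ f) :+ (con 1ℚ :+ l) :- ((con 1ℚ :+ n) :- (con 1ℚ :+ l)) :* g)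
          :+ ((con 1ℚ :+ n) :* v :+ ((con 1ℚ :+ n) :* x :+ (n :- l) :* g)))
      refl (ι n) (ι L) (U n L) (U (suc n) L) (F (suc n) L) (F n L) (F n (suc L)))
  where
  L≤n = ℕ.<⇒≤ L<n

-- Recurrences at the middle of the rows 2r, 2r + 1 and 2r + 2.

ι-double : ∀ r → ι (r ℕ.* 2) ≡ ι r + ι r
ι-double r = begin
  ι (r ℕ.* 2)           ≡⟨ cong ι (ℕ.*-comm r 2) ⟩
  ι (r ℕ.+ (r ℕ.+ 0))   ≡⟨ cong (λ k → ι (r ℕ.+ k)) (ℕ.+-identityʳ r) ⟩
  ι (r ℕ.+ r)           ≡⟨ ι-+ r r ⟩
  ι r + ι r             ∎

r≤r*2 : ∀ r → r ℕ.≤ r ℕ.* 2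
r≤r*2 r = ℕ.m≤m*n r 2

1+ι-double : ∀ r → ι (suc (r ℕ.* 2)) ≡ 1ℚ + (ι r + ι r)
1+ι-double r = trans (ι-suc (r ℕ.* 2)) (cong (λ e → 1ℚ + e) (ι-double r))

-- u is the double sum of (i) for n = 2r, and w is that of (ii), which for n = 2r + 1
-- is also that of (i).
module Middle (r : ℕ) where
  ρ = ι r
  n = r ℕ.* 2
  x = F n r
  x′ = F (suc n) r
  z = F (suc n) (suc r)
  t = F (suc (suc n)) (suc r)
  u = U n r
  v = U (suc n) r
  w = U (suc n) (suc r)
  s = U (suc (suc n)) (suc r)

  w≡v+x′ : w ≡ v + x′
  w≡v+x′ = sum≤<-last r (F (suc n))

  x′-eq : (1ℚ + (ρ + ρ)) * x′ ≡ 2ℚ * ((1ℚ + (ρ + ρ)) - ρ) * x - ρ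
  x′-eq rewrite sym (ι-double r) = F-suc (r≤r*2 r)

  v-eq : (1ℚ + (ρ + ρ)) * v ≡ (2ℚ + (ρ + ρ)) * u + ρ - ((1ℚ + (ρ + ρ)) - ρ) * x
  v-eq rewrite sym (ι-double r) = U-suc (r≤r*2 r)

  -- Once the last term of `w` is split off, the row recurrences for `F` and `U` are added; their
  -- terms free of `F` and `U` cancel.
  w-even : (1ℚ + (ρ + ρ)) * w ≡ (2ℚ + (ρ + ρ)) * u + (1ℚ + ρ) * x
  w-even rewrite w≡v+x′ = ≡-shift (cong₂ _+_ x′-eq v-eq)
    (solve 5 (λ r u v x y →
        (con 1ℚ :+ (r :+ r)) :* (v :+ y)
          :+ ((con 2ℚ :* ((con 1ℚ :+ (r :+ r)) :- r) :* x :- r)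
          :+ ((con 2ℚ :+ (r :+ r)) :* u :+ r :- ((con 1ℚ :+ (r :+ r)) :- r) :* x))
      := ((con 2ℚ :+ (r :+ r)) :* u :+ (con 1ℚ :+ r) :* x)
          :+ ((con 1ℚ :+ (r :+ r)) :* y :+ (con 1ℚ :+ (r :+ r)) :* v))
      refl ρ u v x x′)

  -- The two middle coefficients of row 2r + 1 are equal: at l = r both factors in `F-step` are r +
  -- 1.
  z-eq : z ≡ x′ + 1ℚ
  z-eq = *-cancelˡ-suc r (begin
    (1ℚ + ρ) * z                   ≡⟨ solve 2 (λ r z → (con 1ℚ :+ r) :* z := ((con 1ℚ :+ (r :+ r)) :- r) :* z) refl ρ z ⟩
    ((1ℚ + (ρ + ρ)) - ρ) * z       ≡⟨ cong (λ e → (e - ρ) * z) (1+ι-double r) ⟨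
    (ι (suc n) - ρ) * z            ≡⟨ F-step (s≤s (r≤r*2 r)) ⟩
    (1ℚ + ρ) * (x′ + 1ℚ)           ∎)

  -- At l = r + 1 every coefficient of `F-suc` for row 2r + 1 is a multiple of r + 1, which cancels.
  t-eq : t * 2ℚ + 1ℚ ≡ 2ℚ * z
  t-eq = *-cancelˡ-suc r (≡-shift F-suc′
    (solve 3 (λ r z t →
        (con 1ℚ :+ r) :* (t :* con 2ℚ :+ con 1ℚ)
          :+ (con 2ℚ :* ((con 1ℚ :+ (con 1ℚ :+ (r :+ r))) :- (con 1ℚ :+ r)) :* z :- (con 1ℚ :+ r))
      := (con 1ℚ :+ r) :* (con 2ℚ :* z) :+ (con 1ℚ :+ (con 1ℚ :+ (r :+ r))) :* t)
      refl ρ z t))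
    where
    F-suc′ : (1ℚ + (1ℚ + (ρ + ρ))) * t ≡ 2ℚ * ((1ℚ + (1ℚ + (ρ + ρ))) - (1ℚ + ρ)) * z - (1ℚ + ρ)
    F-suc′ rewrite sym (1+ι-double r) | sym (ι-suc r) = F-suc (s≤s (r≤r*2 r))

  s-eq : (1ℚ + (1ℚ + (ρ + ρ))) * s
       ≡ (2ℚ + (1ℚ + (ρ + ρ))) * w + (1ℚ + ρ) - ((1ℚ + (1ℚ + (ρ + ρ))) - (1ℚ + ρ)) * z
  s-eq rewrite sym (1+ι-double r) | sym (ι-suc r) = U-suc (s≤s (r≤r*2 r))

open Middle hiding (ρ; n)

-- The recurrence for W with its denominators cleared by (r + 1)(r + 2)(2r + 3). `w-even` at `suc r`
-- brings in `s` and `t`; eliminating them by `s-eq` and `t-eq` produces two multiples of `z` that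
-- cancel.
w-suc : ∀ r → let ρ = ι r in
  (1ℚ + ρ) * ((1ℚ + (2ℚ + (ρ + ρ))) * (2ℚ * w (suc r)))
  ≡ (2ℚ + ρ) * ((1ℚ + (2ℚ + (ρ + ρ))) * (2ℚ * w r) + (1ℚ + ρ))
w-suc r = ≡-shift
  (cong₂ _+_ (cong (2ℚ * (1ℚ + ι r) *_) w-even′)
  (cong₂ _+_ (cong (2ℚ * (2ℚ + ι r) *_) (s-eq r))
             (cong (((2ℚ + ι r) * (1ℚ + ι r)) *_) (t-eq r))))
  (solve 6 (λ r w′ s t w z →
      (con 1ℚ :+ r) :* ((con 1ℚ :+ (con 2ℚ :+ (r :+ r))) :* (con 2ℚ :* w′))
        :+ (con 2ℚ :* (con 1ℚ :+ r) :* ((con 2ℚ :+ (con 2ℚ :+ (r :+ r))) :* s :+ (con 1ℚ :+ (con 1ℚ :+ r)) :* t)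
        :+ (con 2ℚ :* (con 2ℚ :+ r) :* ((con 2ℚ :+ (con 1ℚ :+ (r :+ r))) :* w :+ (con 1ℚ :+ r)
              :- ((con 1ℚ :+ (con 1ℚ :+ (r :+ r))) :- (con 1ℚ :+ r)) :* z)
        :+ ((con 2ℚ :+ r) :* (con 1ℚ :+ r)) :* (con 2ℚ :* z)))
    := (con 2ℚ :+ r) :* ((con 1ℚ :+ (con 2ℚ :+ (r :+ r))) :* (con 2ℚ :* w) :+ (con 1ℚ :+ r))
        :+ (con 2ℚ :* (con 1ℚ :+ r) :* ((con 1ℚ :+ (con 2ℚ :+ (r :+ r))) :* w′)
        :+ (con 2ℚ :* (con 2ℚ :+ r) :* ((con 1ℚ :+ (con 1ℚ :+ (r :+ r))) :* s)
        :+ ((con 2ℚ :+ r) :* (con 1ℚ :+ r)) :* (t :* con 2ℚ :+ con 1ℚ))))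
    refl (ι r) (w (suc r)) (s r) (t r) (w r) (z r))
  where
  ι-double-suc : ι (suc r) + ι (suc r) ≡ 2ℚ + (ι r + ι r)
  ι-double-suc rewrite ι-suc r =
    solve 1 (λ r → con 1ℚ :+ r :+ (con 1ℚ :+ r) := con 2ℚ :+ (r :+ r)) refl (ι r)

  w-even′ : (1ℚ + (2ℚ + (ι r + ι r))) * w (suc r)
    ≡ (2ℚ + (2ℚ + (ι r + ι r))) * s r + (1ℚ + (1ℚ + ι r)) * t r
  w-even′ = subst₂ (λ a b → (1ℚ + a) * w (suc r) ≡ (2ℚ + a) * s r + (1ℚ + b) * t r)
    ι-double-suc (ι-suc r) (w-even (suc r))

-- Closed form of the middle double sum.

oddSum : ℕ → ℚ
oddSum r = sum≤< 0 (suc r) (λ m → recip (suc (m ℕ.* 2)))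

recip-suc : ∀ n → recip (suc n) * (1ℚ + ι n) ≡ 1ℚ
recip-suc n = trans (cong (recip (suc n) *_) (sym (ι-suc n))) (recip-inverse (suc n))

-- Induction along `w-suc`, whose increment 1/(2r + 3) is the next term of `oddSum`. The 1 is
-- subtracted because `w 0` vanishes while `oddSum 0` is 1.
double-w : ∀ r → 2ℚ * w r ≡ (1ℚ + ι r) * (oddSum r - 1ℚ)
double-w zero rewrite ι-0 = begin
  2ℚ * (0ℚ + 0ℚ)                       ≡⟨ refl ⟩
  (1ℚ + 0ℚ) * (1ℚ + 0ℚ - 1ℚ)            ≡⟨ cong (λ e → (1ℚ + 0ℚ) * (e + 0ℚ - 1ℚ)) recip-1 ⟨
  (1ℚ + 0ℚ) * (recip 1 + 0ℚ - 1ℚ)       ∎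
  where
  recip-1 : recip 1 ≡ 1ℚ
  recip-1 = trans (sym (*-identityʳ (recip 1))) (trans (cong (recip 1 *_) (sym ι-1)) (recip-inverse 1))
double-w (suc r)
  rewrite sum≤<-last (suc r) (λ m → recip (suc (m ℕ.* 2))) | ι-suc r =
  -- The factors cancelled here and below are 2r + 3 and r + 1.
  *-cancelˡ-suc (suc r ℕ.* 2) (subst (λ e → (1ℚ + e) * (2ℚ * w (suc r))
      ≡ (1ℚ + e) * ((1ℚ + (1ℚ + ι r)) * (oddSum r + q - 1ℚ))) (sym ι-2+2r)
    (*-cancelˡ-suc r (≡-shift
      (cong₂ _+_ (w-suc r)
      (cong₂ _+_ (cong (((2ℚ + ι r) * (1ℚ + (2ℚ + (ι r + ι r)))) *_) (double-w r))
                 (cong (((2ℚ + ι r) * (1ℚ + ι r)) *_) (sym q-inverse))))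
      (solve 5 (λ r w′ w h q →
          (con 1ℚ :+ r) :* ((con 1ℚ :+ (con 2ℚ :+ (r :+ r))) :* (con 2ℚ :* w′))
            :+ ((con 2ℚ :+ r) :* ((con 1ℚ :+ (con 2ℚ :+ (r :+ r))) :* (con 2ℚ :* w) :+ (con 1ℚ :+ r))
            :+ (((con 2ℚ :+ r) :* (con 1ℚ :+ (con 2ℚ :+ (r :+ r)))) :* ((con 1ℚ :+ r) :* (h :- con 1ℚ))
            :+ ((con 2ℚ :+ r) :* (con 1ℚ :+ r)) :* (q :* (con 1ℚ :+ (con 2ℚ :+ (r :+ r))))))
        := (con 1ℚ :+ r) :* ((con 1ℚ :+ (con 2ℚ :+ (r :+ r))) :* ((con 1ℚ :+ (con 1ℚ :+ r)) :* (h :+ q :- con 1ℚ)))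
            :+ ((con 1ℚ :+ r) :* ((con 1ℚ :+ (con 2ℚ :+ (r :+ r))) :* (con 2ℚ :* w′))
            :+ (((con 2ℚ :+ r) :* (con 1ℚ :+ (con 2ℚ :+ (r :+ r)))) :* (con 2ℚ :* w)
            :+ ((con 2ℚ :+ r) :* (con 1ℚ :+ r)) :* con 1ℚ)))
        refl (ι r) (w (suc r)) (w r) (oddSum r) q))))
  where
  q = recip (suc (suc r ℕ.* 2))

  ι-2+2r : ι (suc r ℕ.* 2) ≡ 2ℚ + (ι r + ι r)
  ι-2+2r rewrite ι-double (suc r) | ι-suc r =
    solve 1 (λ r → con 1ℚ :+ r :+ (con 1ℚ :+ r) := con 2ℚ :+ (r :+ r)) refl (ι r)

  q-inverse : q * (1ℚ + (2ℚ + (ι r + ι r))) ≡ 1ℚ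
  q-inverse = trans (cong (λ e → q * (1ℚ + e)) (sym ι-2+2r)) (recip-suc (suc r ℕ.* 2))

-- Powers of two and the central binomial coefficient.

ι-2 : ι 2 ≡ 2ℚ
ι-2 = trans (ι-+ 1 1) (cong₂ _+_ ι-1 ι-1)

-- By the symmetry of row 2r, this says that the row sums to a power of two. The induction avoids
-- symmetry: the coefficient grows by the factor 2(2r + 1)/(r + 1) (`a′-eq`), the other factor by
-- 2(r + 1)/(2r + 1) (`x-suc`), together by 4.
central : ∀ r → ι ((r ℕ.* 2) C r) * (x r * 2ℚ + 1ℚ) ≡ ι (2 ^ (r ℕ.* 2))
central zero rewrite ι-1 = refl
central (suc r) = *-cancelˡ-suc (r ℕ.* 2) (*-cancelˡ-suc r (begin
  (1ℚ + ι r) * ((1ℚ + ι (r ℕ.* 2)) * (a′ * (x (suc r) * 2ℚ + 1ℚ)))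
    ≡⟨ cong (λ e → (1ℚ + ι r) * ((1ℚ + e) * (a′ * (x (suc r) * 2ℚ + 1ℚ)))) (ι-double r) ⟩
  (1ℚ + ι r) * ((1ℚ + (ι r + ι r)) * (a′ * (x (suc r) * 2ℚ + 1ℚ)))
    ≡⟨ solve 4 (λ c d a x → c :* (d :* (a :* x)) := c :* a :* (d :* x)) refl (1ℚ + ι r) (1ℚ + (ι r + ι r)) a′ (x (suc r) * 2ℚ + 1ℚ) ⟩
  (1ℚ + ι r) * a′ * ((1ℚ + (ι r + ι r)) * (x (suc r) * 2ℚ + 1ℚ))
    ≡⟨ cong₂ _*_ a′-eq x-suc ⟩
  2ℚ * (1ℚ + (ι r + ι r)) * a * (2ℚ * (1ℚ + ι r) * (x r * 2ℚ + 1ℚ))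
    ≡⟨ solve 4 (λ c d a x → con 2ℚ :* d :* a :* (con 2ℚ :* c :* x) := c :* (d :* (con 2ℚ :* (con 2ℚ :* (a :* x))))) refl (1ℚ + ι r) (1ℚ + (ι r + ι r)) a (x r * 2ℚ + 1ℚ) ⟩
  (1ℚ + ι r) * ((1ℚ + (ι r + ι r)) * (2ℚ * (2ℚ * (a * (x r * 2ℚ + 1ℚ)))))
    ≡⟨ cong₂ (λ e p → (1ℚ + ι r) * ((1ℚ + e) * p)) (sym (ι-double r)) power ⟩
  (1ℚ + ι r) * ((1ℚ + ι (r ℕ.* 2)) * ι (2 ^ (suc r ℕ.* 2))) ∎))
  where
  a = ι ((r ℕ.* 2) C r)
  b = ι (suc (r ℕ.* 2) C r)
  a′ = ι ((suc r ℕ.* 2) C suc r)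

  power : 2ℚ * (2ℚ * (a * (x r * 2ℚ + 1ℚ))) ≡ ι (2 ^ (suc r ℕ.* 2))
  power rewrite ι-* 2 (2 ℕ.* 2 ^ (r ℕ.* 2)) | ι-* 2 (2 ^ (r ℕ.* 2)) | ι-2 =
    cong (λ e → 2ℚ * (2ℚ * e)) (central r)

  diagonal : (1ℚ + ι r) * a′ ≡ (1ℚ + (1ℚ + (ι r + ι r))) * b
  diagonal rewrite sym (1+ι-double r) = absorption-diagonal (suc (r ℕ.* 2)) r

  row : ((1ℚ + (ι r + ι r)) - ι r) * b ≡ (1ℚ + (ι r + ι r)) * a
  row rewrite sym (ι-double r) = absorption-row (r ℕ.* 2) r

  a′-eq : (1ℚ + ι r) * a′ ≡ 2ℚ * (1ℚ + (ι r + ι r)) * a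
  a′-eq = ≡-shift (cong₂ _+_ diagonal (cong (2ℚ *_) row))
    (solve 4 (λ r a b a′ →
        (con 1ℚ :+ r) :* a′
          :+ ((con 1ℚ :+ (con 1ℚ :+ (r :+ r))) :* b :+ con 2ℚ :* ((con 1ℚ :+ (r :+ r)) :* a))
      := con 2ℚ :* (con 1ℚ :+ (r :+ r)) :* a
          :+ ((con 1ℚ :+ r) :* a′ :+ con 2ℚ :* (((con 1ℚ :+ (r :+ r)) :- r) :* b)))
      refl (ι r) a b a′)

  x-suc : (1ℚ + (ι r + ι r)) * (x (suc r) * 2ℚ + 1ℚ) ≡ 2ℚ * (1ℚ + ι r) * (x r * 2ℚ + 1ℚ)
  x-suc = begin
    -- `x (suc r)` and `t r` agree by computation, so `t-eq` applies.
    (1ℚ + (ι r + ι r)) * (x (suc r) * 2ℚ + 1ℚ)  ≡⟨ cong ((1ℚ + (ι r + ι r)) *_) (t-eq r) ⟩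
    (1ℚ + (ι r + ι r)) * (2ℚ * z r)             ≡⟨ cong (λ e → (1ℚ + (ι r + ι r)) * (2ℚ * e)) (z-eq r) ⟩
    (1ℚ + (ι r + ι r)) * (2ℚ * (x′ r + 1ℚ))     ≡⟨ ≡-shift (cong (2ℚ *_) (x′-eq r))
      (solve 3 (λ r x y →
          (con 1ℚ :+ (r :+ r)) :* (con 2ℚ :* (y :+ con 1ℚ))
            :+ con 2ℚ :* (con 2ℚ :* ((con 1ℚ :+ (r :+ r)) :- r) :* x :- r)
        := con 2ℚ :* (con 1ℚ :+ r) :* (x :* con 2ℚ :+ con 1ℚ)
            :+ con 2ℚ :* ((con 1ℚ :+ (r :+ r)) :* y))
        refl (ι r) (x r) (x′ r)) ⟩
    2ℚ * (1ℚ + ι r) * (x r * 2ℚ + 1ℚ)           ∎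

-- Binomial expansion of Beta values.

binomialSum : ℕ → (ℕ → ℚ) → ℚ
binomialSum N g = sum≤< 0 (suc N) (λ j → ι (N C j) * g j)

binomialSum-cong : ∀ N {g g′} → (∀ j → g j ≡ g′ j) → binomialSum N g ≡ binomialSum N g′
binomialSum-cong N g≗g′ = sum≤<-cong (suc N) (λ j _ → cong (ι (N C j) *_) (g≗g′ j))

-- With E the shift of sequences, `binomialSum N g` is the value of (1 + E)ᴺ g at 0, and this peels
-- off one factor 1 + E by Pascal's rule.
binomialSum-suc : ∀ N g → binomialSum (suc N) g ≡ binomialSum N g + binomialSum N (λ j → g (suc j))
binomialSum-suc N g = begin
  binomialSum (suc N) g
    ≡⟨ cong (λ e → ι 1 * g 0 + e) (sum≤<-cong (suc N) (λ j _ → split j)) ⟩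
  ι 1 * g 0 + sum≤< 0 (suc N) (λ j → ι (N C j) * g (suc j) + ι (N C suc j) * g (suc j))
    ≡⟨ cong (λ e → ι 1 * g 0 + e) (∑-distrib-+ {suc N} (λ j → ι (N C toℕ j) * g (suc (toℕ j))) (λ j → ι (N C suc (toℕ j)) * g (suc (toℕ j)))) ⟩
  ι 1 * g 0 + (shifted + rest)
    ≡⟨ solve 3 (λ a b c → a :+ (b :+ c) := (a :+ c) :+ b) refl (ι 1 * g 0) shifted rest ⟩
  (ι 1 * g 0 + rest) + shifted
    -- The first two summands form a sum up to j = N + 1, one term too long; the extra coefficient
    -- C(N,N+1) is zero.
    ≡⟨ cong (_+ shifted) (sum≤<-last (suc N) (λ j → ι (N C j) * g j)) ⟩
  (binomialSum N g + ι (N C suc N) * g (suc N)) + shifted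
    ≡⟨ cong (λ e → (binomialSum N g + e) + shifted) vanish ⟩
  (binomialSum N g + 0ℚ) + shifted
    ≡⟨ cong (_+ shifted) (+-identityʳ (binomialSum N g)) ⟩
  binomialSum N g + shifted ∎
  where
  shifted = binomialSum N (λ j → g (suc j))
  rest = sum≤< 0 (suc N) (λ j → ι (N C suc j) * g (suc j))

  split : ∀ j → ι (suc N C suc j) * g (suc j) ≡ ι (N C j) * g (suc j) + ι (N C suc j) * g (suc j)
  split j = trans (cong (_* g (suc j)) (pascal N j)) (*-distribʳ-+ (g (suc j)) (ι (N C j)) (ι (N C suc j)))

  vanish : ι (N C suc N) * g (suc N) ≡ 0ℚ
  vanish = trans (cong (λ e → ι e * g (suc N)) (k>n⇒nCk≡0 (ℕ.n<1+n N)))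
    (trans (cong (_* g (suc N)) ι-0) (*-zeroˡ (g (suc N))))

-- For k ≤ n this is the Beta value B(k + 1, n - k + 1).
β : ℕ → ℕ → ℚ
β n k = recip (suc n) * recip (n C k)

-- Under the integral this is (1 - x) + x = 1. Algebraically, the reciprocals in row n + 1 are (n +
-- 1 - k)/(n + 1) and (k + 1)/(n + 1) times that of C(n,k), and these weights add up to (n + 2)/(n +
-- 1).
β-step : ∀ {n k} → k ℕ.≤ n → β (suc n) k + β (suc n) (suc k) ≡ β n k
β-step {n} {k} k≤n = *-cancelˡ-suc n (≡-shift
  (cong₂ _+_ (cong (i′ *_) (sym row))
  (cong₂ _+_ (cong (i′ *_) (sym diagonal))
  (cong₂ _+_ (cong (p *_) i′-inverse) (cong (p *_) (sym (recip-suc n))))))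
  (solve 7 (λ n k i i′ p q q′ →
      (con 1ℚ :+ n) :* (i′ :* q :+ i′ :* q′)
        :+ (i′ :* (((con 1ℚ :+ n) :- k) :* p) :+ (i′ :* ((con 1ℚ :+ k) :* p) :+ (p :* con 1ℚ :+ p :* (i :* (con 1ℚ :+ n)))))
    := (con 1ℚ :+ n) :* (i :* p)
        :+ (i′ :* ((con 1ℚ :+ n) :* q) :+ (i′ :* ((con 1ℚ :+ n) :* q′) :+ (p :* (i′ :* (con 1ℚ :+ (con 1ℚ :+ n))) :+ p :* con 1ℚ))))
    refl (ι n) (ι k) i i′ p q q′))
  where
  i = recip (suc n)
  i′ = recip (suc (suc n))
  p = recip (n C k)
  q = recip (suc n C k)
  q′ = recip (suc n C suc k)

  row : ((1ℚ + ι n) - ι k) * p ≡ (1ℚ + ι n) * q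
  row = recip-cross q p (ι (suc n C k)) (ι (n C k)) ((1ℚ + ι n) - ι k) (1ℚ + ι n)
    (recip-C (ℕ.m≤n⇒m≤1+n k≤n)) (recip-C k≤n) (absorption-row n k)

  diagonal : (1ℚ + ι k) * p ≡ (1ℚ + ι n) * q′
  diagonal = recip-cross q′ p (ι (suc n C suc k)) (ι (n C k)) (1ℚ + ι k) (1ℚ + ι n)
    (recip-C (s≤s k≤n)) (recip-C k≤n) (absorption-diagonal n k)

  i′-inverse : i′ * (1ℚ + (1ℚ + ι n)) ≡ 1ℚ
  i′-inverse = trans (cong (λ e → i′ * (1ℚ + e)) (sym (ι-suc n))) (recip-suc (suc n))

-- Under the integral, (x + (1 - x))ᴺ = 1 is expanded against xᵏ(1 - x)ⁿ⁻ᵏ. Each induction step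
-- applies the hypothesis at (n + 1, k) and (n + 1, k + 1), so n and k stay general.
binomialSum-β : ∀ N {n k} → k ℕ.≤ n → binomialSum N (λ j → β (n ℕ.+ N) (k ℕ.+ j)) ≡ β n k
binomialSum-β zero    {n} {k} _ rewrite ℕ.+-identityʳ n | ℕ.+-identityʳ k | ι-1 =
  trans (+-identityʳ (1ℚ * β n k)) (*-identityˡ (β n k))
binomialSum-β (suc N) {n} {k} k≤n = begin
  binomialSum (suc N) (λ j → β (n ℕ.+ suc N) (k ℕ.+ j))
    ≡⟨ binomialSum-suc N (λ j → β (n ℕ.+ suc N) (k ℕ.+ j)) ⟩
  binomialSum N (λ j → β (n ℕ.+ suc N) (k ℕ.+ j)) + binomialSum N (λ j → β (n ℕ.+ suc N) (k ℕ.+ suc j))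
    ≡⟨ cong₂ _+_
         (binomialSum-cong N (λ j → cong (λ e → β e (k ℕ.+ j)) (ℕ.+-suc n N)))
         (binomialSum-cong N (λ j → cong₂ β (ℕ.+-suc n N) (ℕ.+-suc k j))) ⟩
  binomialSum N (λ j → β (suc n ℕ.+ N) (k ℕ.+ j)) + binomialSum N (λ j → β (suc n ℕ.+ N) (suc k ℕ.+ j))
    ≡⟨ cong₂ _+_ (binomialSum-β N (ℕ.m≤n⇒m≤1+n k≤n)) (binomialSum-β N (s≤s k≤n)) ⟩
  β (suc n) k + β (suc n) (suc k)
    ≡⟨ β-step k≤n ⟩
  β n k ∎

-- Expression (iii).

innerIII : ℕ → ℕ → ℚ
innerIII n m = sum≤≤ m (n ∸ m) (λ ℓ →
  (((2 ℕ.* m) C m) ℕ.* ((n ∸ 2 ℕ.* m) C (ℓ ∸ m))) // (n C ℓ))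

-- Writing n = 2m + N and ℓ = m + j makes every truncated subtraction compute to its true value. The
-- sum over j then collapses to `β (2 * m) m`, whose reciprocal of C(2m,m) cancels the constant
-- factor C(2m,m).
innerIII≡ : ∀ m N → let n = 2 ℕ.* m ℕ.+ N in innerIII n m ≡ ι (suc n) * recip (suc (2 ℕ.* m))
innerIII≡ m N = begin
  sum≤< 0 (suc (n ∸ m) ∸ m) term
    ≡⟨ cong (λ L → sum≤< 0 L term) length ⟩
  sum≤< 0 (suc N) term
    ≡⟨ sum≤<-cong (suc N) (λ j _ → term≡ j) ⟩
  sum≤< 0 (suc N) (λ j → K * (ι (N C j) * β n (m ℕ.+ j)))
    ≡⟨ *-distribˡ-sum {suc N} K (λ j → ι (N C toℕ j) * β n (m ℕ.+ toℕ j)) ⟨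
  K * binomialSum N (λ j → β n (m ℕ.+ j))
    ≡⟨ cong (K *_) (binomialSum-β N m≤a) ⟩
  ι (a C m) * ι (suc n) * (recip (suc a) * recip (a C m))
    ≡⟨ solve 4 (λ c n i p → c :* n :* (i :* p) := n :* i :* (p :* c)) refl (ι (a C m)) (ι (suc n)) (recip (suc a)) (recip (a C m)) ⟩
  ι (suc n) * recip (suc a) * (recip (a C m) * ι (a C m))
    ≡⟨ cong (ι (suc n) * recip (suc a) *_) (recip-C m≤a) ⟩
  ι (suc n) * recip (suc a) * 1ℚ
    ≡⟨ *-identityʳ (ι (suc n) * recip (suc a)) ⟩
  ι (suc n) * recip (suc a) ∎
  where
  a = 2 ℕ.* m
  n = a ℕ.+ N
  K = ι (a C m) * ι (suc n)
  m≤a = ℕ.m≤n*m m 2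

  term : ℕ → ℚ
  term j = ((a C m) ℕ.* ((n ∸ a) C ((m ℕ.+ j) ∸ m))) // (n C (m ℕ.+ j))

  n≡m+[m+N] : n ≡ m ℕ.+ (m ℕ.+ N)
  n≡m+[m+N] = trans (cong (λ e → m ℕ.+ e ℕ.+ N) (ℕ.+-identityʳ m)) (ℕ.+-assoc m m N)

  length : suc (n ∸ m) ∸ m ≡ suc N
  length = begin
    suc (n ∸ m) ∸ m                  ≡⟨ cong (λ e → suc (e ∸ m) ∸ m) n≡m+[m+N] ⟩
    suc (m ℕ.+ (m ℕ.+ N) ∸ m) ∸ m    ≡⟨ cong (λ e → suc e ∸ m) (ℕ.m+n∸m≡n m (m ℕ.+ N)) ⟩
    suc (m ℕ.+ N) ∸ m                ≡⟨ cong (_∸ m) (ℕ.+-suc m N) ⟨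
    m ℕ.+ suc N ∸ m                  ≡⟨ ℕ.m+n∸m≡n m (suc N) ⟩
    suc N                            ∎

  term≡ : ∀ j → term j ≡ K * (ι (N C j) * β n (m ℕ.+ j))
  term≡ j rewrite ℕ.m+n∸m≡n a N | ℕ.m+n∸m≡n m j = begin
    ((a C m) ℕ.* (N C j)) // (n C (m ℕ.+ j))
      ≡⟨ //≡ι*recip ((a C m) ℕ.* (N C j)) (n C (m ℕ.+ j)) ⟩
    ι ((a C m) ℕ.* (N C j)) * p
      ≡⟨ cong (_* p) (ι-* (a C m) (N C j)) ⟩
    ι (a C m) * ι (N C j) * p
      ≡⟨ *-identityʳ (ι (a C m) * ι (N C j) * p) ⟨
    ι (a C m) * ι (N C j) * p * 1ℚ
      -- The inserted unit supplies the factor 1/(n + 1) of `β n`; the matching n + 1 goes into `K`.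
      ≡⟨ cong (ι (a C m) * ι (N C j) * p *_) (recip-inverse (suc n)) ⟨
    ι (a C m) * ι (N C j) * p * (recip (suc n) * ι (suc n))
      ≡⟨ solve 5 (λ c d p i n → c :* d :* p :* (i :* n) := c :* n :* (d :* (i :* p))) refl (ι (a C m)) (ι (N C j)) p (recip (suc n)) (ι (suc n)) ⟩
    K * (ι (N C j) * β n (m ℕ.+ j)) ∎
    where p = recip (n C (m ℕ.+ j))

exprIII≡oddSum : ∀ n → exprIII n ≡ oddSum ⌊ n /2⌋
exprIII≡oddSum n = begin
  (1 // suc n) * sum≤< 0 (suc ⌊ n /2⌋) (innerIII n)
    ≡⟨ cong₂ _*_ (//≡ι*recip 1 (suc n)) (sum≤<-cong (suc ⌊ n /2⌋) inner) ⟩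
  ι 1 * i * sum≤< 0 (suc ⌊ n /2⌋) (λ m → ι (suc n) * recip (suc (m ℕ.* 2)))
    ≡⟨ cong₂ (λ e f → e * i * f) ι-1 (sym (*-distribˡ-sum {suc ⌊ n /2⌋} (ι (suc n)) (λ m → recip (suc (toℕ m ℕ.* 2))))) ⟩
  1ℚ * i * (ι (suc n) * oddSum ⌊ n /2⌋)
    ≡⟨ solve 3 (λ i n h → con 1ℚ :* i :* (n :* h) := i :* n :* h) refl i (ι (suc n)) (oddSum ⌊ n /2⌋) ⟩
  i * ι (suc n) * oddSum ⌊ n /2⌋
    ≡⟨ cong (_* oddSum ⌊ n /2⌋) (recip-inverse (suc n)) ⟩
  1ℚ * oddSum ⌊ n /2⌋
    ≡⟨ *-identityˡ (oddSum ⌊ n /2⌋) ⟩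
  oddSum ⌊ n /2⌋ ∎
  where
  i = recip (suc n)

  2m≤n : ∀ {m} → m ℕ.≤ ⌊ n /2⌋ → 2 ℕ.* m ℕ.≤ n
  2m≤n {m} m≤n/2 = subst₂ ℕ._≤_ (cong (m ℕ.+_) (sym (ℕ.+-identityʳ m))) (ℕ.⌊n/2⌋+⌈n/2⌉≡n n)
    (ℕ.+-mono-≤ m≤n/2 (ℕ.≤-trans m≤n/2 (ℕ.⌊n/2⌋≤⌈n/2⌉ n)))

  inner : ∀ m → m ℕ.< suc ⌊ n /2⌋ → innerIII n m ≡ ι (suc n) * recip (suc (m ℕ.* 2))
  inner m (s≤s m≤n/2) = subst₂ (λ e a → innerIII e m ≡ ι (suc e) * recip (suc a))
    (ℕ.m+[n∸m]≡n (2m≤n m≤n/2)) (ℕ.*-comm 2 m) (innerIII≡ m (n ∸ 2 ℕ.* m))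

-- Expression (ii).

exprII≡oddSum : ∀ n → exprII n ≡ oddSum ⌊ n /2⌋
exprII≡oddSum n = begin
  (2 // suc r) * U (2 ℕ.* r ℕ.+ 1) (suc r) + 1ℚ
    ≡⟨ cong₂ (λ e N → e * U N (suc r) + 1ℚ) (//≡ι*recip 2 (suc r)) N≡ ⟩
  ι 2 * p * w r + 1ℚ
    ≡⟨ cong (λ e → e * p * w r + 1ℚ) ι-2 ⟩
  2ℚ * p * w r + 1ℚ
    ≡⟨ ≡-shift (cong₂ _+_ (cong (p *_) (double-w r)) (cong (_* (oddSum r - 1ℚ)) (recip-suc r)))
       (solve 4 (λ r p w h →
           con 2ℚ :* p :* w :+ con 1ℚ
             :+ (p :* ((con 1ℚ :+ r) :* (h :- con 1ℚ)) :+ con 1ℚ :* (h :- con 1ℚ))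
         := h :+ (p :* (con 2ℚ :* w) :+ p :* (con 1ℚ :+ r) :* (h :- con 1ℚ)))
         refl (ι r) p (w r) (oddSum r)) ⟩
  oddSum r ∎
  where
  r = ⌊ n /2⌋
  p = recip (suc r)

  N≡ : 2 ℕ.* r ℕ.+ 1 ≡ suc (r ℕ.* 2)
  N≡ = trans (ℕ.+-comm (2 ℕ.* r) 1) (cong suc (ℕ.*-comm 2 r))

-- Parity and halving.

data Parity : ℕ → Set where
  even : ∀ r → Parity (r ℕ.* 2)
  odd  : ∀ r → Parity (suc (r ℕ.* 2))

parity : ∀ n → Parity n
parity zero = even 0
parity (suc n) with parity n
... | even r = odd r
-- `suc r * 2` computes to `suc (suc (r * 2))`, which the form `2 * r` would not do.
... | odd r  = even (suc r)

⌊r*2/2⌋≡r : ∀ r → ⌊ r ℕ.* 2 /2⌋ ≡ r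
⌊r*2/2⌋≡r zero    = refl
⌊r*2/2⌋≡r (suc r) = cong suc (⌊r*2/2⌋≡r r)

⌈r*2/2⌉≡r : ∀ r → ⌈ r ℕ.* 2 /2⌉ ≡ r
⌈r*2/2⌉≡r zero    = refl
⌈r*2/2⌉≡r (suc r) = cong suc (⌈r*2/2⌉≡r r)

⟦⟧-true : ∀ {P : Set} (P? : Dec P) → P → ⟦ P? ⟧ ≡ 1ℚ
⟦⟧-true (yes _) _ = refl
⟦⟧-true (no ¬p) p = contradiction p ¬p

⟦⟧-false : ∀ {P : Set} (P? : Dec P) → ¬ P → ⟦ P? ⟧ ≡ 0ℚ
⟦⟧-false (yes p) ¬p = contradiction p ¬p
⟦⟧-false (no _)  _  = refl

2∤1+r*2 : ∀ r → ¬ 2 ∣ suc (r ℕ.* 2)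
2∤1+r*2 r 2∣ with ∣1⇒≡1 (∣m+n∣m⇒∣n (subst (2 ∣_) (ℕ.+-comm 1 (r ℕ.* 2)) 2∣) (n∣m*n r))
... | ()

-- Expression (i), for even and for odd n.

exprI-even : ∀ r → exprI (r ℕ.* 2) ≡ oddSum r
exprI-even r
  rewrite ⌈r*2/2⌉≡r r | ⌊r*2/2⌋≡r r | ⟦⟧-true (2 ∣? r ℕ.* 2) (n∣m*n r) = begin
  (4 // suc (r ℕ.* 2)) * u r + 1ℚ * ((1 // suc (r ℕ.* 2)) * ((2 ^ (r ℕ.* 2)) // c - 1ℚ)) + 1ℚ
    ≡⟨ cong₂ (λ e f → e * u r + 1ℚ * f + 1ℚ)
         (trans (//≡ι*recip 4 (suc (r ℕ.* 2))) (cong (_* i) ι-4))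
         (cong₂ (λ e f → e * (f - 1ℚ))
           (trans (//≡ι*recip 1 (suc (r ℕ.* 2))) (cong (_* i) ι-1)) central′) ⟩
  -- The 1 subtracted in the bracketed term cancels the 1 from `central′`, leaving 2 F(2r,r).
  2ℚ * 2ℚ * i * u r + 1ℚ * (1ℚ * i * (x r * 2ℚ + 1ℚ - 1ℚ)) + 1ℚ
    ≡⟨ solve 3 (λ i u x →
         con 2ℚ :* con 2ℚ :* i :* u :+ con 1ℚ :* (con 1ℚ :* i :* (x :* con 2ℚ :+ con 1ℚ :- con 1ℚ)) :+ con 1ℚ
         := i :* (con 2ℚ :* (con 2ℚ :* u :+ x)) :+ con 1ℚ) refl i (u r) (x r) ⟩
  i * (2ℚ * (2ℚ * u r + x r)) + 1ℚ
    ≡⟨ cong (λ e → i * e + 1ℚ) numerator ⟩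
  i * ((1ℚ + (ι r + ι r)) * (oddSum r - 1ℚ)) + 1ℚ
    ≡⟨ ≡-shift (cong (_* (oddSum r - 1ℚ)) i-inverse)
       (solve 3 (λ i d h → i :* (d :* (h :- con 1ℚ)) :+ con 1ℚ :+ con 1ℚ :* (h :- con 1ℚ)
         := h :+ i :* d :* (h :- con 1ℚ)) refl i (1ℚ + (ι r + ι r)) (oddSum r)) ⟩
  oddSum r ∎
  where
  c = (r ℕ.* 2) C r
  i = recip (suc (r ℕ.* 2))

  ι-4 : ι 4 ≡ 2ℚ * 2ℚ
  ι-4 = trans (ι-* 2 2) (cong₂ _*_ ι-2 ι-2)

  i-inverse : i * (1ℚ + (ι r + ι r)) ≡ 1ℚ
  i-inverse = trans (cong (i *_) (sym (1+ι-double r))) (recip-inverse (suc (r ℕ.* 2)))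

  central′ : (2 ^ (r ℕ.* 2)) // c ≡ x r * 2ℚ + 1ℚ
  central′ = begin
    (2 ^ (r ℕ.* 2)) // c                               ≡⟨ //≡ι*recip (2 ^ (r ℕ.* 2)) c ⟩
    ι (2 ^ (r ℕ.* 2)) * recip c                        ≡⟨ cong (_* recip c) (central r) ⟨
    ι c * (x r * 2ℚ + 1ℚ) * recip c              ≡⟨ solve 3 (λ c x p → c :* x :* p := p :* c :* x) refl (ι c) (x r * 2ℚ + 1ℚ) (recip c) ⟩
    recip c * ι c * (x r * 2ℚ + 1ℚ)              ≡⟨ cong (_* (x r * 2ℚ + 1ℚ)) (recip-C (r≤r*2 r)) ⟩
    1ℚ * (x r * 2ℚ + 1ℚ)                         ≡⟨ *-identityˡ (x r * 2ℚ + 1ℚ) ⟩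
    x r * 2ℚ + 1ℚ                                ∎

  -- Multiplied by r + 1, the left side is twice the right side of `w-even`, that is 2(2r + 1) W;
  -- `double-w` then evaluates it.
  numerator : 2ℚ * (2ℚ * u r + x r) ≡ (1ℚ + (ι r + ι r)) * (oddSum r - 1ℚ)
  numerator = *-cancelˡ-suc r (≡-shift
    (cong₂ _+_ (cong (2ℚ *_) (sym (w-even r))) (cong ((1ℚ + (ι r + ι r)) *_) (double-w r)))
    (solve 5 (λ r u x w h →
        (con 1ℚ :+ r) :* (con 2ℚ :* (con 2ℚ :* u :+ x))
          :+ (con 2ℚ :* ((con 1ℚ :+ (r :+ r)) :* w) :+ (con 1ℚ :+ (r :+ r)) :* ((con 1ℚ :+ r) :* (h :- con 1ℚ)))
      := (con 1ℚ :+ r) :* ((con 1ℚ :+ (r :+ r)) :* (h :- con 1ℚ))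
          :+ (con 2ℚ :* ((con 2ℚ :+ (r :+ r)) :* u :+ (con 1ℚ :+ r) :* x) :+ (con 1ℚ :+ (r :+ r)) :* (con 2ℚ :* w)))
      refl (ι r) (u r) (x r) (w r) (oddSum r)))

exprI-odd : ∀ r → exprI (suc (r ℕ.* 2)) ≡ oddSum r
exprI-odd r
  -- `⌈ suc (r * 2) /2⌉` computes to `suc ⌊ r * 2 /2⌋`, so the double sum becomes exactly `w r`.
  rewrite ⌊r*2/2⌋≡r r | ⟦⟧-false (2 ∣? suc (r ℕ.* 2)) (2∤1+r*2 r) = begin
  (4 // suc (suc (r ℕ.* 2))) * w r + 0ℚ * e + 1ℚ
    ≡⟨ cong₂ (λ a b → a * w r + b + 1ℚ)
         (trans (//≡ι*recip 4 (suc (suc (r ℕ.* 2)))) (cong (_* i) (trans (ι-* 2 2) (cong₂ _*_ ι-2 ι-2)))) (*-zeroˡ e) ⟩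
  2ℚ * 2ℚ * i * w r + 0ℚ + 1ℚ
    ≡⟨ ≡-shift (cong₂ _+_ (cong (2ℚ * i *_) (double-w r)) (cong (_* (oddSum r - 1ℚ)) i-inverse))
       (solve 4 (λ r i w h →
           con 2ℚ :* con 2ℚ :* i :* w :+ con 0ℚ :+ con 1ℚ
             :+ (con 2ℚ :* i :* ((con 1ℚ :+ r) :* (h :- con 1ℚ)) :+ con 1ℚ :* (h :- con 1ℚ))
         := h :+ (con 2ℚ :* i :* (con 2ℚ :* w) :+ i :* (con 1ℚ :+ (con 1ℚ :+ (r :+ r))) :* (h :- con 1ℚ)))
         refl (ι r) i (w r) (oddSum r)) ⟩
  oddSum r ∎
  where
  i = recip (suc (suc (r ℕ.* 2)))
  e = (1 // suc (suc (r ℕ.* 2))) * ((2 ^ suc (r ℕ.* 2)) // (suc (r ℕ.* 2) C ⌈ r ℕ.* 2 /2⌉) - 1ℚ)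

  i-inverse : i * (1ℚ + (1ℚ + (ι r + ι r))) ≡ 1ℚ
  i-inverse = trans (cong (λ e → i * (1ℚ + e)) (sym (1+ι-double r))) (recip-suc (suc (r ℕ.* 2)))

-- Expression (iv).

Hᵒᵈᵈ-suc : ∀ n → Hᵒᵈᵈ (suc n) ≡ Hᵒᵈᵈ n + ⟦ ¬? (2 ∣? suc n) ⟧ * (1 // suc n)
Hᵒᵈᵈ-suc n = sum≤<-last n (λ k → ⟦ ¬? (2 ∣? suc k) ⟧ * (1 // suc k))

-- Proved by mutual recursion with `Hᵒᵈᵈ-even`: the even case at r uses the odd case at r, and the
-- odd case at r + 1 uses the even case at r.
Hᵒᵈᵈ-odd : ∀ r → Hᵒᵈᵈ (suc (r ℕ.* 2)) ≡ oddSum r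

Hᵒᵈᵈ-even : ∀ r → Hᵒᵈᵈ (suc r ℕ.* 2) ≡ oddSum r
Hᵒᵈᵈ-even r = begin
  Hᵒᵈᵈ (suc r ℕ.* 2)         ≡⟨ Hᵒᵈᵈ-suc (suc (r ℕ.* 2)) ⟩
  Hᵒᵈᵈ (suc (r ℕ.* 2)) + ⟦ ¬? (2 ∣? suc r ℕ.* 2) ⟧ * q
    ≡⟨ cong₂ (λ a b → a + b * q) (Hᵒᵈᵈ-odd r) (⟦⟧-false (¬? (2 ∣? suc r ℕ.* 2)) (λ 2∤ → 2∤ (n∣m*n (suc r)))) ⟩
  oddSum r + 0ℚ * q               ≡⟨ cong (λ a → oddSum r + a) (*-zeroˡ q) ⟩
  oddSum r + 0ℚ                   ≡⟨ +-identityʳ (oddSum r) ⟩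
  oddSum r                        ∎
  where q = 1 // (suc r ℕ.* 2)

Hᵒᵈᵈ-odd r = begin
  Hᵒᵈᵈ (suc (r ℕ.* 2))       ≡⟨ Hᵒᵈᵈ-suc (r ℕ.* 2) ⟩
  Hᵒᵈᵈ (r ℕ.* 2) + ⟦ ¬? (2 ∣? suc (r ℕ.* 2)) ⟧ * (1 // suc (r ℕ.* 2))
    ≡⟨ cong₂ (λ a b → Hᵒᵈᵈ (r ℕ.* 2) + a * b) (⟦⟧-true (¬? (2 ∣? suc (r ℕ.* 2))) (2∤1+r*2 r))
         (trans (//≡ι*recip 1 (suc (r ℕ.* 2))) (cong (_* q) ι-1)) ⟩
  Hᵒᵈᵈ (r ℕ.* 2) + 1ℚ * (1ℚ * q)  ≡⟨ cong (λ a → Hᵒᵈᵈ (r ℕ.* 2) + a) (trans (*-identityˡ (1ℚ * q)) (*-identityˡ q)) ⟩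
  Hᵒᵈᵈ (r ℕ.* 2) + q         ≡⟨ previous r ⟩
  oddSum r                        ∎
  where
  q = recip (suc (r ℕ.* 2))

  previous : ∀ r → Hᵒᵈᵈ (r ℕ.* 2) + recip (suc (r ℕ.* 2)) ≡ oddSum r
  previous zero    = +-comm 0ℚ (recip 1)
  previous (suc r) = trans (cong (_+ recip (suc (suc r ℕ.* 2))) (Hᵒᵈᵈ-even r))
    (sym (sum≤<-last (suc r) (λ m → recip (suc (m ℕ.* 2)))))

-- Joining the parity cases and the four expressions.

exprI≡oddSum : ∀ n → exprI n ≡ oddSum ⌊ n /2⌋
exprI≡oddSum n with parity n
... | even r = trans (exprI-even r) (cong oddSum (sym (⌊r*2/2⌋≡r r)))
-- `⌊ suc (r * 2) /2⌋` is `⌈ r * 2 /2⌉` by the definition of the ceiling.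
... | odd r  = trans (exprI-odd r) (cong oddSum (sym (⌈r*2/2⌉≡r r)))

exprIV≡oddSum : ∀ n → exprIV n ≡ oddSum ⌊ n /2⌋
exprIV≡oddSum n with parity n
... | even r = trans (cong Hᵒᵈᵈ (ℕ.+-comm (r ℕ.* 2) 1))
  (trans (Hᵒᵈᵈ-odd r) (cong oddSum (sym (⌊r*2/2⌋≡r r))))
... | odd r  = trans (cong Hᵒᵈᵈ (ℕ.+-comm (suc (r ℕ.* 2)) 1))
  (trans (Hᵒᵈᵈ-even r) (cong oddSum (sym (⌈r*2/2⌉≡r r))))

mainTheorem6 : (n : ℕ) →
    (exprI n ≡ exprII n) × (exprII n ≡ exprIII n) × (exprIII n ≡ exprIV n)
mainTheorem6 n =
  trans (exprI≡oddSum n) (sym (exprII≡oddSum n)) ,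
  trans (exprII≡oddSum n) (sym (exprIII≡oddSum n)) ,
  trans (exprIII≡oddSum n) (sym (exprIV≡oddSum n))
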